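{- To find an XSAT-solution for an $l$-regular exactly $\lambda$-connected CNF formula is equivalent to finding a parallel class in the corresponding $(m,l,\lambda)$-BIBD.
   Context: All CNF formulas are assumed monotone (all literals are of one kind), so a clause $C$ is identified with its set of variables $Var(C)$. An exactly $\lambda$-connected CNF formula is a set $F$ of clauses $C_i$ over a variable set $Var(F)$ with $C_i\in 2^{Var(F)}$ such that any two clauses have exactly $\lambda$ variables in common. It is $l$-regular if each variable occurs in exactly $l$ clauses; $m=|F|$ is the number of clauses. For a variable $a$ put $\Phi(a)=\{C\in F: a\in Var(C)\}$. An XSAT-solution of $F$ is a subset $L\subseteq Var(F)$ which induces a partition of the clause set, i.e. the sets $\Phi(a)$, $a\in L$, partition $F$; equivalently, setting all variables in $L$ to true and all others to false makes exactly one variable true in each clause. A $(m,l,\lambda)$-BIBD (balanced incomplete block design) is a pair of finite sets $(X,B)$ of $m=|X|$ points and $|B|$ blocks such that each block is a proper subset of $X$, every block contains exactly $l<m$ points, and every pair of points is contained in exactly $\lambda$ blocks. The BIBD corresponding to $F$ has point set $X=F$ and block set $B=\{\Phi(a): a\in Var(F)\}$. Two blocks are parallel if they have no point in common; a parallel class is a set of pairwise parallel blocks which partitions the point set. -}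

module Defs where

open import Data.Fin using (Fin)
open import Data.Fin.Subset using (Subset; _∈_; _∩_; _⊂_; ⊤; Empty; ∣_∣)
open import Data.Fin.Subset.Properties using (_∈?_)
open import Data.List as List using (List; length; filter; allFin)
import Data.List.Membership.Propositional as ListMem
open import Data.List.Relation.Binary.Subset.Propositional using (_⊆_)
open import Data.Nat using (ℕ; _<_)
open import Data.Product using (∃-syntax; _×_)
open import Data.Vec using (lookup; tabulate)
open import Function.Definitions using (Injective)
open import Relation.Binary.PropositionalEquality using (_≡_; _≢_)
open import Relation.Nullary.Decidable using (_×-dec_)

-- A monotone CNF formula with m clauses over the variable set Fin n.
-- Injectivity says that the clauses form a set, so that m = |F|.
record CNF (m n : ℕ) : Set where
  field
    clause           : Fin m → Subset n
    clause-injective : Injective _≡_ _≡_ clause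

open CNF public

-- Φ(a) = { C ∈ F : a ∈ Var(C) }, with the clause C_i represented by its index i.
Φ : ∀ {m n} → CNF m n → Fin n → Subset m
Φ F a = tabulate λ i → lookup (clause F i) a

IsRegular : ∀ {m n} → ℕ → CNF m n → Set
IsRegular l F = ∀ a → ∣ Φ F a ∣ ≡ l

IsExactlyConnected : ∀ {m n} → ℕ → CNF m n → Set
IsExactlyConnected λ′ F = ∀ {i j} → i ≢ j → ∣ clause F i ∩ clause F j ∣ ≡ λ′

-- The sets Φ(a), a ∈ L, form a partition as an indexed family: different
-- variables a ≠ b in L must have disjoint Φ(a), Φ(b) even if Φ(a) = Φ(b).
-- Equivalently, every clause contains exactly one variable of L.
record IsXSATSolution {m n} (F : CNF m n) (L : Subset n) : Set where
  field
    disjoint : ∀ {a b} → a ∈ L → b ∈ L → a ≢ b → Empty (Φ F a ∩ Φ F b)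
    covers   : ∀ i → ∃[ a ] a ∈ L × i ∈ Φ F a

-- The blocks of a design on the point set Fin m.  Repeated blocks are allowed
-- and are counted with multiplicity: two variables of a formula may occur in
-- exactly the same clauses, and then counting Φ(a) = Φ(b) only once would make
-- the number of blocks through a pair of points smaller than λ.
Blocks : ℕ → Set
Blocks m = List (Subset m)

record IsBIBD (m l λ′ : ℕ) (B : Blocks m) : Set where
  field
    l<m       : l < m
    proper    : ∀ {b} → b ListMem.∈ B → b ⊂ ⊤
    blockSize : ∀ {b} → b ListMem.∈ B → ∣ b ∣ ≡ l
    balanced  : ∀ {x y} → x ≢ y →
                length (filter (λ b → (x ∈? b) ×-dec (y ∈? b)) B) ≡ λ′

Parallel : ∀ {m} → Subset m → Subset m → Set
Parallel b c = Empty (b ∩ c)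

-- P stands for the set of its members; order and repetitions in P are irrelevant.
record IsParallelClass {m} (B : Blocks m) (P : List (Subset m)) : Set where
  field
    areBlocks : P ⊆ B
    parallel  : ∀ {b c} → b ListMem.∈ P → c ListMem.∈ P → b ≢ c → Parallel b c
    covers    : ∀ x → ∃[ b ] b ListMem.∈ P × x ∈ b

-- The block collection { Φ(a) : a ∈ Var(F) } on the point set F.
blocksOf : ∀ {m n} → CNF m n → Blocks m
blocksOf {n = n} F = List.map (Φ F) (allFin n)

-- The set { Φ(a) : a ∈ L }.
Φ-image : ∀ {m n} → CNF m n → Subset n → List (Subset m)
Φ-image {n = n} F L = List.map (Φ F) (filter (_∈? L) (allFin n))

{-# OPTIONS --safe #-}
-- A variable a lies in clause C exactly when the block Φ(a) contains the point C,
-- so both sides speak of the same partitions of F; the number of blocks through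
-- two points is the number of variables common to the two clauses. As distinct
-- variables may have equal blocks, a parallel class P is turned into a solution
-- by taking one canonical variable for each block of P. For l < m: if l ≥ m then
-- every variable occurs in every clause, so any two clauses coincide.
module Submission where

open import Data.Bool using (true)
import Data.Bool.Properties as Bool
open import Data.Fin using (Fin; zero; suc)
open import Data.Fin.Properties as Fin using (any?)
open import Data.Fin.Subset using (Subset; inside; outside; _∈_; _∩_; _⊂_; ⊤; ∣_∣)
open import Data.Fin.Subset.Properties
  using (_∈?_; ∈⊤; ⊆⊤; ⊆-antisym; drop-there; ∣p∣≤n; ∣p∣≡n⇒p≡⊤; out⊂in; s⊂s; x∈p∩q⁺; x∈p∩q⁻)
open import Data.List as List using (List; length; filter; allFin)
import Data.List.Membership.Propositional as ListMem
open import Data.List.Membership.Propositional.Properties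
  using (∈-map⁺; ∈-map⁻; ∈-filter⁺; ∈-filter⁻; ∈-allFin)
import Data.List.Membership.DecPropositional as DecMem
open import Data.List.Properties using (map-tabulate; filter-accept; filter-reject)
open import Data.List.Relation.Binary.BagAndSetEquality using (_∼[_]_; set)
open import Data.Nat as ℕ using (ℕ; _≤_; _<_; s≤s; z≤n)
open import Data.Nat.Properties using (≤-antisym; ≰⇒>)
open import Data.Product using (∃; ∃-syntax; _×_; _,_; proj₁; proj₂)
open import Data.Vec using (_∷_; []; lookup; tabulate; here; there)
open import Data.Vec.Properties
  using (≡-dec; []=⇒lookup; lookup⇒[]=; lookup∘tabulate; tabulate∘lookup; tabulate-cong)
open import Function.Base using (_∘_)
open import Function.Bundles using (_⇔_; mk⇔; Equivalence)
open import Relation.Binary.Definitions using (DecidableEquality)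
open import Relation.Binary.PropositionalEquality
  using (_≡_; _≢_; refl; sym; trans; cong; subst; module ≡-Reasoning)
open import Relation.Nullary using (Dec; yes; does)
open import Relation.Nullary.Decidable using (_×-dec_; recompute; dec-true)
open import Relation.Unary using (Pred; Decidable)
open import Defs

open Equivalence using (to; from)

module _ {m n} (F : CNF m n) where

  -- `Φ F` reads the incidence matrix with rows `clause F i` by columns, so both memberships look up
  -- the same Boolean entry.
  ∈Φ⇔∈clause : ∀ {a i} → i ∈ Φ F a ⇔ a ∈ clause F i
  ∈Φ⇔∈clause {a} {i} = mk⇔
    (λ i∈ → lookup⇒[]= a _ (trans (sym lookup-Φ) ([]=⇒lookup i∈)))
    (λ a∈ → lookup⇒[]= i _ (trans lookup-Φ ([]=⇒lookup a∈)))
    where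
    lookup-Φ : lookup (Φ F a) i ≡ lookup (clause F i) a
    lookup-Φ = lookup∘tabulate _ i

_≟ˢ_ : ∀ {n} → DecidableEquality (Subset n)
_≟ˢ_ = ≡-dec Bool._≟_

-- The first `outside` entry is a missing point. Each `inside` entry before it lowers both sides of
-- the inequality by one.
∣p∣<n⇒p⊂⊤ : ∀ {n} {p : Subset n} → ∣ p ∣ < n → p ⊂ ⊤
∣p∣<n⇒p⊂⊤ {p = outside ∷ p} _         = out⊂in ⊆⊤
∣p∣<n⇒p⊂⊤ {p = inside  ∷ p} (s≤s p<n) = s⊂s (∣p∣<n⇒p⊂⊤ p<n)

all∈⇒≡⊤ : ∀ {n} {p : Subset n} → (∀ a → a ∈ p) → p ≡ ⊤
all∈⇒≡⊤ {p = p} all∈ = ⊆-antisym ⊆⊤ (λ {a} _ → all∈ a)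

-- The count runs over positions, not values: equal values of `f` at different positions count
-- separately, as repeated blocks must.
length-filter-tabulate : ∀ {n ℓ ℓ′} {A : Set ℓ} {P : Pred A ℓ′} (P? : Decidable P)
  (f : Fin n → A) (p : Subset n) → (∀ {a} → P (f a) ⇔ a ∈ p) →
  length (filter P? (List.tabulate f)) ≡ ∣ p ∣
length-filter-tabulate P? f []      P⇔∈ = refl
length-filter-tabulate P? f (s ∷ p) P⇔∈ with
  length-filter-tabulate P? (f ∘ suc) p (mk⇔ (drop-there ∘ to P⇔∈) (from P⇔∈ ∘ there))
length-filter-tabulate P? f (inside  ∷ p) P⇔∈ | ih =
  trans (cong length (filter-accept P? (from P⇔∈ here))) (cong ℕ.suc ih)
length-filter-tabulate P? f (outside ∷ p) P⇔∈ | ih =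
  trans (cong length (filter-reject P? ((λ ()) ∘ to P⇔∈))) ih

comprehension : ∀ {n ℓ} {P : Pred (Fin n) ℓ} → Decidable P → Subset n
comprehension P? = tabulate (does ∘ P?)

∈-comprehension : ∀ {n ℓ} {P : Pred (Fin n) ℓ} (P? : Decidable P) {a} →
  a ∈ comprehension P? ⇔ P a
∈-comprehension P? {a} = mk⇔
  (λ a∈ → does⇒ (P? a) (trans (sym (lookup∘tabulate _ a)) ([]=⇒lookup a∈)))
  (λ Pa → lookup⇒[]= a _ (trans (lookup∘tabulate _ a) (dec-true (P? a) Pa)))
  where
  does⇒ : ∀ {ℓ} {A : Set ℓ} (A? : Dec A) → does A? ≡ true → A
  does⇒ (yes a) _ = a

module Representative {ℓ n} {A : Set ℓ} (_≟_ : DecidableEquality A) (f : Fin n → A) where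

  -- The preimage argument is irrelevant, so the result depends on the value alone.
  preimage : ∀ b → .(∃[ a ] f a ≡ b) → ∃[ a ] f a ≡ b
  preimage b = recompute (any? λ a → f a ≟ b)

  rep : Fin n → Fin n
  rep a = proj₁ (preimage (f a) (a , refl))

  f-rep : ∀ a → f (rep a) ≡ f a
  f-rep a = proj₂ (preimage (f a) (a , refl))

  rep-cong : ∀ {a b} → f a ≡ f b → rep a ≡ rep b
  rep-cong {a} {b} = preimage-cong (a , refl) (b , refl)
    where
    -- Matching `f a ≡ f b` with `refl` would get stuck on the applications of `f`. With variables
    -- `x` and `y` it succeeds, and the two sides then differ only in an irrelevant argument.
    preimage-cong : ∀ {x y} (p : ∃[ a ] f a ≡ x) (q : ∃[ a ] f a ≡ y) →
      x ≡ y → proj₁ (preimage x p) ≡ proj₁ (preimage y q)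
    preimage-cong p q refl = refl

module _ {m n} (F : CNF m n) where

  ∈-blocksOf⁺ : ∀ a → Φ F a ListMem.∈ blocksOf F
  ∈-blocksOf⁺ a = ∈-map⁺ (Φ F) (∈-allFin a)

  ∈-blocksOf⁻ : ∀ {b} → b ListMem.∈ blocksOf F → ∃[ a ] b ≡ Φ F a
  ∈-blocksOf⁻ b∈ with a , _ , eq ← ∈-map⁻ (Φ F) b∈ = a , eq

  ∈-Φ-image⁺ : ∀ {L a} → a ∈ L → Φ F a ListMem.∈ Φ-image F L
  ∈-Φ-image⁺ {L} {a} a∈L = ∈-map⁺ (Φ F) (∈-filter⁺ (_∈? L) (∈-allFin a) a∈L)

  ∈-Φ-image⁻ : ∀ {L b} → b ListMem.∈ Φ-image F L → ∃[ a ] a ∈ L × b ≡ Φ F a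
  ∈-Φ-image⁻ {L} b∈ with a , a∈ , eq ← ∈-map⁻ (Φ F) b∈ =
    a , proj₂ (∈-filter⁻ (_∈? L) {xs = allFin n} a∈) , eq

  -- The bound `2 ≤ m` supplies the two distinct indices whose clauses injectivity separates. A
  -- single clause containing every variable has `l = m = 1`.
  regular⇒l<m : ∀ {l} → 2 ≤ m → IsRegular l F → l < m
  regular⇒l<m {l} (s≤s (s≤s z≤n)) regular = ≰⇒> λ m≤l →
    Fin.0≢1+n (clause-injective F (trans (clause≡⊤ m≤l zero) (sym (clause≡⊤ m≤l (suc zero)))))
    where
    Φ≡⊤ : m ≤ l → ∀ a → Φ F a ≡ ⊤
    Φ≡⊤ m≤l a = ∣p∣≡n⇒p≡⊤
      (≤-antisym (∣p∣≤n (Φ F a)) (subst (m ≤_) (sym (regular a)) m≤l))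

    clause≡⊤ : m ≤ l → ∀ i → clause F i ≡ ⊤
    clause≡⊤ m≤l i = all∈⇒≡⊤ λ a → to (∈Φ⇔∈clause F) (subst (i ∈_) (sym (Φ≡⊤ m≤l a)) ∈⊤)

  blocksThroughPair : ∀ x y →
    length (filter (λ b → (x ∈? b) ×-dec (y ∈? b)) (blocksOf F)) ≡ ∣ clause F x ∩ clause F y ∣
  blocksThroughPair x y = begin
    length (filter through? (blocksOf F))
      -- `allFin n` is itself a tabulation, so the mapped list becomes one tabulated directly by
      -- `Φ F`, as the counting lemma expects.
      ≡⟨ cong (length ∘ filter through?) (map-tabulate (λ a → a) (Φ F)) ⟩
    length (filter through? (List.tabulate (Φ F)))
      ≡⟨ length-filter-tabulate through? (Φ F) (clause F x ∩ clause F y) through⇔common ⟩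
    ∣ clause F x ∩ clause F y ∣ ∎
    where
    open ≡-Reasoning

    through? : Decidable (λ b → x ∈ b × y ∈ b)
    through? b = (x ∈? b) ×-dec (y ∈? b)

    through⇔common : ∀ {a} → (x ∈ Φ F a × y ∈ Φ F a) ⇔ a ∈ clause F x ∩ clause F y
    through⇔common = mk⇔
      (λ (x∈ , y∈) → x∈p∩q⁺ (to (∈Φ⇔∈clause F) x∈ , to (∈Φ⇔∈clause F) y∈))
      (λ a∈ → let ax , ay = x∈p∩q⁻ _ _ a∈ in
        from (∈Φ⇔∈clause F) ax , from (∈Φ⇔∈clause F) ay)

  blocksOf-isBIBD : ∀ {l λ′} → IsRegular l F → IsExactlyConnected λ′ F → 2 ≤ m →
    IsBIBD m l λ′ (blocksOf F)
  blocksOf-isBIBD {l} regular connected 2≤m = record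
    { l<m       = l<m
    ; proper    = λ b∈ → ∣p∣<n⇒p⊂⊤ (subst (_< m) (sym (blockSize b∈)) l<m)
    ; blockSize = blockSize
    ; balanced  = λ {x} {y} x≢y → trans (blocksThroughPair x y) (connected x≢y)
    }
    where
    l<m : l < m
    l<m = regular⇒l<m 2≤m regular

    blockSize : ∀ {b} → b ListMem.∈ blocksOf F → ∣ b ∣ ≡ l
    blockSize b∈ with a , refl ← ∈-blocksOf⁻ b∈ = regular a

  solution⇒parallelClass : ∀ L → IsXSATSolution F L →
    IsParallelClass (blocksOf F) (Φ-image F L)
  solution⇒parallelClass L solution = record
    { areBlocks = areBlocks
    ; parallel  = parallel
    ; covers    = λ i → let a , a∈L , i∈Φa = covers i in Φ F a , ∈-Φ-image⁺ a∈L , i∈Φa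
    }
    where
    open IsXSATSolution solution

    areBlocks : ∀ {b} → b ListMem.∈ Φ-image F L → b ListMem.∈ blocksOf F
    areBlocks b∈ with a , _ , refl ← ∈-Φ-image⁻ {L} b∈ = ∈-blocksOf⁺ a

    parallel : ∀ {b c} → b ListMem.∈ Φ-image F L → c ListMem.∈ Φ-image F L → b ≢ c → Parallel b c
    parallel b∈ c∈ b≢c
      with a , a∈L , refl ← ∈-Φ-image⁻ {L} b∈ | a′ , a′∈L , refl ← ∈-Φ-image⁻ {L} c∈ =
      disjoint a∈L a′∈L (b≢c ∘ cong (Φ F))

  parallelClass⇒solution : ∀ P → IsParallelClass (blocksOf F) P →
    ∃[ L ] (IsXSATSolution F L × (Φ-image F L ∼[ set ] P))
  parallelClass⇒solution P parallelClass = L , solution , mk⇔ image⊆P P⊆image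
    where
    open IsParallelClass parallelClass
    open Representative _≟ˢ_ (Φ F)
    open DecMem (_≟ˢ_ {m}) using () renaming (_∈?_ to _∈ˡ?_)

    -- Taking every variable whose block lies in `P` would break disjointness when two of them share
    -- a nonempty block. The fixed points of `rep` keep exactly one variable per block.
    isRep? : Decidable (λ a → Φ F a ListMem.∈ P × rep a ≡ a)
    isRep? a = (Φ F a ∈ˡ? P) ×-dec (rep a Fin.≟ a)

    L : Subset n
    L = comprehension isRep?

    block⇒rep : ∀ {b} → b ListMem.∈ P → ∃[ a ] a ∈ L × b ≡ Φ F a
    block⇒rep b∈P with a , refl ← ∈-blocksOf⁻ (areBlocks b∈P) =
      -- `rep a` has the same block as `a`, and `rep-cong` applied to this equality shows that it is
      -- a fixed point of `rep`.
      rep a ,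
      from (∈-comprehension isRep?)
        (subst (ListMem._∈ P) (sym (f-rep a)) b∈P , rep-cong (f-rep a)) ,
      sym (f-rep a)

    solution : IsXSATSolution F L
    solution = record { disjoint = disjoint ; covers = coversL }
      where
      disjoint : ∀ {a b} → a ∈ L → b ∈ L → a ≢ b → Parallel (Φ F a) (Φ F b)
      disjoint a∈L b∈L a≢b
        with Φa∈P , ra≡a ← to (∈-comprehension isRep?) a∈L
           | Φb∈P , rb≡b ← to (∈-comprehension isRep?) b∈L =
        -- `parallel` only separates distinct blocks. If the blocks were equal, both variables would
        -- be the one representative of that block, contradicting `a ≢ b`.
        parallel Φa∈P Φb∈P λ Φa≡Φb → a≢b (trans (sym ra≡a) (trans (rep-cong Φa≡Φb) rb≡b))

      coversL : ∀ i → ∃[ a ] a ∈ L × i ∈ Φ F a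
      coversL i with b , b∈P , i∈b ← covers i with a , a∈L , refl ← block⇒rep b∈P =
        a , a∈L , i∈b

    image⊆P : ∀ {b} → b ListMem.∈ Φ-image F L → b ListMem.∈ P
    image⊆P b∈ with a , a∈L , refl ← ∈-Φ-image⁻ {L} b∈ =
      proj₁ (to (∈-comprehension isRep?) a∈L)

    P⊆image : ∀ {b} → b ListMem.∈ P → b ListMem.∈ Φ-image F L
    P⊆image b∈P with a , a∈L , refl ← block⇒rep b∈P = ∈-Φ-image⁺ a∈L

mainTheorem3 : ∀ {m n} (F : CNF m n) (l λ′ : ℕ) → IsRegular l F → IsExactlyConnected λ′ F →
    (2 ≤ m → IsBIBD m l λ′ (blocksOf F))
    × (∃ (IsXSATSolution F) ⇔ ∃ (IsParallelClass (blocksOf F)))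
    × (∀ L → IsXSATSolution F L → IsParallelClass (blocksOf F) (Φ-image F L))
    × (∀ P → IsParallelClass (blocksOf F) P → ∃[ L ] (IsXSATSolution F L × (Φ-image F L ∼[ set ] P)))
mainTheorem3 F l λ′ regular connected =
  blocksOf-isBIBD F regular connected ,
  mk⇔ (λ (L , solution) → Φ-image F L , solution⇒parallelClass F L solution)
      (λ (P , parallelClass) →
        let L , solution , _ = parallelClass⇒solution F P parallelClass in L , solution) ,
  solution⇒parallelClass F ,
  parallelClass⇒solution F
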